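{- Let $(\Gamma,\mathbf{q})$ be a polarized metrized graph of genus $\bar g$ with an adequate vertex set $V(\Gamma)$. Let $\mathrm{L}=(l_{pq})_{p,q\in V(\Gamma)}$ be the discrete Laplacian matrix of $\Gamma$ with respect to $V(\Gamma)$, and let $\mathrm{L}^+=(l^+_{pq})_{p,q\in V(\Gamma)}$ be its Moore–Penrose pseudo inverse. Then $$\theta(\Gamma)=2(2\bar g-2)\sum_{p\in V(\Gamma)}\big(\upsilon(p)-2+2\mathbf{q}(p)\big)\,l^+_{pp}\;-\;2\sum_{p,\,q\in V(\Gamma)}\big(\upsilon(p)+2\mathbf{q}(p)\big)\big(\upsilon(q)+2\mathbf{q}(q)\big)\,l^+_{pq}.$$
   Context: Metrized graph: a finite connected graph $\Gamma$ in which each edge $e_i$ is identified with a closed line segment of length $L_i>0$; multiple edges and self-loops are allowed. The valence $\upsilon(p)$ of $p\in\Gamma$ is the number of directions emanating from $p$. A vertex set $V(\Gamma)$ is a finite non-empty subset of $\Gamma$ containing all points with $\upsilon(p)\neq 2$; it may be enlarged by adding valence-2 points. Given $V(\Gamma)$, $E(\Gamma)$ is the corresponding set of edges, $e=|E(\Gamma)|$, $v=|V(\Gamma)|$, and $g(\Gamma)=e-v+1$. Adequate vertex set: $V(\Gamma)$ is adequate if, with respect to it, $\Gamma$ has no self-loops and no multiple edges joining two vertices. Resistance function: $r(x,y)$ is the effective resistance between $x,y\in\Gamma$ when $\Gamma$ is regarded as a resistive electric circuit in which the resistance of each edge is its length. Polarized metrized graph (pm-graph): a pair $(\Gamma,\mathbf{q})$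 where $\mathbf{q}:\Gamma\to\mathbb{N}=\{0,1,2,\dots\}$ is supported on the vertex set $V(\Gamma)$ (in particular $\mathbf q=0$ at any valence-2 points added to the vertex set to make it adequate), such that the canonical divisor $K=\sum_{p\in V(\Gamma)}(\upsilon(p)-2+2\mathbf{q}(p))\,p$ is effective, i.e. all its coefficients are $\ge 0$. Its genus is $\bar g=1+\frac12\deg K=g(\Gamma)+\sum_{p\in V(\Gamma)}\mathbf{q}(p)$. Invariant $\theta$: $\theta(\Gamma)=\sum_{p,\,q\in V(\Gamma)}(\upsilon(p)-2+2\mathbf{q}(p))(\upsilon(q)-2+2\mathbf{q}(q))\,r(p,q)$, the sum being over all ordered pairs. Discrete Laplacian (for an adequate vertex set): $\mathrm{L}=(l_{pq})$ is the $v\times v$ matrix with $l_{pq}=0$ if $p\ne q$ are not adjacent, $l_{pq}=-1/L_k$ if $p\neq q$ are joined by an edge of length $L_k$, and $l_{pp}=-\sum_{s\in V(\Gamma)\setminus\{p\}}l_{ps}$. -}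

module Defs where

open import Level using (Level; suc; _⊔_)
open import Data.Bool.Base using (if_then_else_)
open import Data.Fin.Base using (Fin)
open import Data.Fin.Properties using (_≟_; any?)
open import Data.Integer.Base as ℤ using (ℤ; +_; -[1+_])
open import Data.Nat.Base as ℕ using (ℕ; NonZero)
open import Data.Product.Base using (∃-syntax; _×_; _,_; proj₁)
open import Data.Sum.Base using (_⊎_)
open import Function.Base using (flip)
open import Relation.Binary.Core using (Rel)
open import Relation.Binary.Structures using (IsStrictPartialOrder)
open import Relation.Binary.Construct.Closure.ReflexiveTransitive using (Star)
open import Relation.Binary.PropositionalEquality.Core using (_≡_; _≢_)
open import Relation.Nullary.Decidable.Core using (Dec; does; yes; no; _×-dec_; _⊎-dec_)
open import Algebra.Apartness.Bundles using (HeytingField; HeytingCommutativeRing)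
open import Algebra.Bundles using (CommutativeRing)
import Algebra.Definitions.RawMonoid as RawMonoidDefs
import Algebra.Properties.CommutativeMonoid.Sum as MonoidSum
import Algebra.Properties.Ring as RingProperties

private
  module ℕΣ = RawMonoidDefs ℕ.+-0-rawMonoid
  module ℤΣ = RawMonoidDefs ℤ.+-0-rawMonoid

-- The scalars: ℝ is an instance, both classically (with _#_ the negation of
-- _≈_) and constructively.  Completeness plays no role, so it is not assumed.
record OrderedField c ℓ₁ ℓ₂ ℓ₃ : Set (suc (c ⊔ ℓ₁ ⊔ ℓ₂ ⊔ ℓ₃)) where
  infix 4 _<_
  field
    heytingField : HeytingField c ℓ₁ ℓ₂

  open HeytingField heytingField public

  field
    _<_                  : Rel Carrier ℓ₃
    isStrictPartialOrder : IsStrictPartialOrder _≈_ _<_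
    #⇒<⊎>                : ∀ {x y} → x # y → x < y ⊎ y < x
    <⇒#                  : ∀ {x y} → x < y → x # y
    +-monoˡ-<            : ∀ z {x y} → x < y → (x + z) < (y + z)
    *-pos                : ∀ {x y} → 0# < x → 0# < y → 0# < (x * y)

  commutativeRing : CommutativeRing c ℓ₁
  commutativeRing = HeytingCommutativeRing.commutativeRing heytingCommutativeRing

module Metrized {c ℓ₁ ℓ₂ ℓ₃ : Level} (F : OrderedField c ℓ₁ ℓ₂ ℓ₃) where

  open OrderedField F public
    using (Carrier; _≈_; _#_; _<_; _+_; _*_; -_; _-_; 0#; 1#)
  open OrderedField F
    using ( commutativeRing; <⇒#; #⇒invertible; #-sym
          ; trans; sym; *-congʳ; +-identityʳ; +-congˡ )
  open CommutativeRing commutativeRing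
    using (+-commutativeMonoid; +-rawMonoid; ring)

  open MonoidSum +-commutativeMonoid public using (sum; sum-syntax)
  private module ℕ× = RawMonoidDefs +-rawMonoid

  fromℤ : ℤ → Carrier
  fromℤ (+ n)    = n ℕ×.× 1#
  fromℤ -[1+ n ] = - (ℕ.suc n ℕ×.× 1#)

  -- A Heyting field supplies this as the inverse of x - 0#.
  recip : (x : Carrier) → 0# < x → Carrier
  recip x 0<x = proj₁ (#⇒invertible (#-sym (<⇒# 0<x)))

  recip-inverseʳ : ∀ x (0<x : 0# < x) → x * recip x 0<x ≈ 1#
  recip-inverseʳ x 0<x with #⇒invertible (#-sym (<⇒# 0<x))
  ... | _ , _ , inverseʳ =
    trans (*-congʳ (sym (trans (+-congˡ -0#≈0#) (+-identityʳ x)))) inverseʳ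
    where open RingProperties ring using (-0#≈0#)

  Matrix : ℕ → ℕ → Set c
  Matrix m n = Fin m → Fin n → Carrier

  infixl 7 _⊗_
  infix  4 _≈ᴹ_

  _⊗_ : ∀ {l m n} → Matrix l m → Matrix m n → Matrix l n
  _⊗_ {m = m} A B i k = ∑[ j < m ] (A i j * B j k)

  _≈ᴹ_ : ∀ {m n} → Rel (Matrix m n) ℓ₁
  A ≈ᴹ B = ∀ i j → A i j ≈ B i j

  -- The four Penrose equations; flip is transposition.
  record IsMoorePenroseInverse {m n} (A : Matrix m n) (A⁺ : Matrix n m) : Set ℓ₁ where
    field
      AA⁺A≈A      : A ⊗ A⁺ ⊗ A ≈ᴹ A
      A⁺AA⁺≈A⁺    : A⁺ ⊗ A ⊗ A⁺ ≈ᴹ A⁺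
      AA⁺-symmetric : flip (A ⊗ A⁺) ≈ᴹ A ⊗ A⁺
      A⁺A-symmetric : flip (A⁺ ⊗ A) ≈ᴹ A⁺ ⊗ A

  -- A metrized graph together with a chosen vertex set: a finite connected
  -- multigraph, self-loops allowed, with positive edge lengths.  Edge k is a
  -- segment from src k to tgt k; the orientation is only a parametrisation.
  record MetrizedGraph : Set (c ⊔ ℓ₃) where
    field
      v e        : ℕ
      src tgt    : Fin e → Fin v
      len        : Fin e → Carrier
      len-pos    : ∀ k → 0# < len k

    Joins : Fin e → Fin v → Fin v → Set
    Joins k p q = (src k ≡ p × tgt k ≡ q) ⊎ (src k ≡ q × tgt k ≡ p)

    field
      {{nonEmpty}} : NonZero v
      connected    : ∀ p q → Star (λ s t → ∃[ k ] Joins k s t) p q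

    joins? : ∀ k p q → Dec (Joins k p q)
    joins? k p q = ((src k ≟ p) ×-dec (tgt k ≟ q)) ⊎-dec ((src k ≟ q) ×-dec (tgt k ≟ p))

    1/len : Fin e → Carrier
    1/len k = recip (len k) (len-pos k)

    -- Each end of an edge gives one direction, so a self-loop counts twice.
    υ : Fin v → ℕ
    υ p = ℕΣ.sum λ k → (if does (src k ≟ p) then 1 else 0)
                   ℕ.+ (if does (tgt k ≟ p) then 1 else 0)

    g : ℤ
    g = + e ℤ.- + v ℤ.+ + 1

    Adequate : Set
    Adequate = (∀ k → src k ≢ tgt k)
             × (∀ k l p q → Joins k p q → Joins l p q → k ≡ l)

    -- Ohm's law: the current through edge k, from src k to tgt k, for the
    -- potential φ.
    current : (Fin v → Carrier) → Fin e → Carrier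
    current φ k = (φ (src k) - φ (tgt k)) * 1/len k

    netOutflow : (Fin v → Carrier) → Fin v → Carrier
    netOutflow φ p = ∑[ k < e ] ( (if does (src k ≟ p) then current φ k else 0#)
                                - (if does (tgt k ≟ p) then current φ k else 0#) )

    δ : Fin v → Fin v → Carrier
    δ x p = if does (x ≟ p) then 1# else 0#

    -- Kirchhoff's current law, with unit current entering the circuit at x and
    -- leaving it at y.
    UnitCurrentPotential : Fin v → Fin v → (Fin v → Carrier) → Set ℓ₁
    UnitCurrentPotential x y φ = ∀ p → netOutflow φ p ≈ δ x p - δ y p

    -- The effective resistance is the potential difference driving a unit
    -- current; only its values at vertices are recorded.
    IsResistanceFunction : (Fin v → Fin v → Carrier) → Set (c ⊔ ℓ₁)
    IsResistanceFunction r =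
      ∀ x y → ∃[ φ ] (UnitCurrentPotential x y φ × r x y ≈ φ x - φ y)

    -- For an adequate vertex set at most one edge joins p and q, so the choice
    -- made by any? is immaterial.
    offDiagonal : Fin v → Fin v → Carrier
    offDiagonal p q with any? (λ k → joins? k p q)
    ... | yes (k , _) = - 1/len k
    ... | no  _       = 0#

    discreteLaplacian : Matrix v v
    discreteLaplacian p q =
      if does (p ≟ q)
      then - (∑[ s < v ] (if does (p ≟ s) then 0# else offDiagonal p s))
      else offDiagonal p q

  record PMGraph : Set (c ⊔ ℓ₃) where
    field
      Γ : MetrizedGraph
    open MetrizedGraph Γ public
    field
      𝐪 : Fin v → ℕ

    K : Fin v → ℤ
    K p = + υ p ℤ.- + 2 ℤ.+ + 2 ℤ.* + 𝐪 p

    field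
      K-effective : ∀ p → + 0 ℤ.≤ K p

    genus : ℤ
    genus = g ℤ.+ ℤΣ.sum (λ p → + 𝐪 p)

    θ : (Fin v → Fin v → Carrier) → Carrier
    θ r = ∑[ p < v ] ∑[ q < v ] (fromℤ (K p) * fromℤ (K q) * r p q)

{-# OPTIONS --safe #-}
-- A potential φ with Lφ = d = δₓ - δᵧ gives r(x,y) = dᵀφ = φᵀLφ = φᵀLL⁺Lφ = dᵀL⁺d,
-- so r(x,y) = l⁺ₓₓ - l⁺ₓᵧ - l⁺ᵧₓ + l⁺ᵧᵧ.  Summing against K ⊗ K, the diagonal terms
-- produce the factor deg K = 2ḡ - 2; in the others K may be replaced by K + 2,
-- because constants lie in the kernel of L and hence in both kernels of L⁺.

module Submission where

open import Defs
open import Data.Fin.Base using (Fin; zero; suc; punchIn)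
open import Data.Integer.Base as ℤ using (+_)

open import Algebra.Bundles using (CommutativeMonoid; CommutativeRing)
import Algebra.Definitions.RawMonoid as RawMonoidDefs
import Algebra.Properties.CommutativeMonoid.Sum as MonoidSum
import Algebra.Properties.CommutativeSemigroup as CommutativeSemigroupProperties
import Algebra.Properties.Monoid.Mult as MonoidMult
import Algebra.Properties.Ring as RingProperties
import Algebra.Properties.Semiring.Sum as SemiringSum
open import Data.Bool.Base using (if_then_else_)
open import Data.Fin.Properties using (_≟_; any?; punchInᵢ≢i)
import Data.Integer.Properties as ℤ
open import Data.Integer.Tactic.RingSolver using (solve-∀)
open import Data.Nat.Base as ℕ using (ℕ)
import Data.Nat.Properties as ℕ
open import Data.Product.Base using (_×_; _,_; proj₁; proj₂)
open import Data.Sum.Base using (inj₁; inj₂)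
open import Function.Base using (_∘_; flip)
open import Relation.Binary.PropositionalEquality as ≡ using (_≡_; _≢_)
import Relation.Binary.Reasoning.Setoid as SetoidReasoning
open import Relation.Nullary using (¬_; yes; no; contradiction)
open import Relation.Nullary.Decidable using (does)

private
  module ℕΣ = RawMonoidDefs ℕ.+-0-rawMonoid
  module ℤΣ = RawMonoidDefs ℤ.+-0-rawMonoid

-- Finite sums with at most one nonzero term, and integer bookkeeping.

module SupportedSum {c ℓ} (M : CommutativeMonoid c ℓ) where
  open CommutativeMonoid M
  open MonoidSum M

  sum-zero : ∀ {n} {f : Fin n → Carrier} → (∀ i → f i ≈ ε) → sum f ≈ ε
  sum-zero {n} f≈0 = trans (sum-cong-≋ f≈0) (sum-replicate-zero n)

  sum-single : ∀ {n} (f : Fin n → Carrier) i → (∀ j → j ≢ i → f j ≈ ε) → sum f ≈ f i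
  sum-single {ℕ.suc n} f i f≈0 = trans (sum-remove f)
    (trans (∙-congˡ (sum-zero λ j → f≈0 (punchIn i j) (punchInᵢ≢i i j))) (identityʳ _))

sum-indicator : ∀ {n} (i : Fin n) → ℕΣ.sum (λ p → if does (i ≟ p) then 1 else 0) ≡ 1
sum-indicator i = ≡.trans (sum-single _ i off) on
  where
  open SupportedSum ℕ.+-0-commutativeMonoid
  off : ∀ j → j ≢ i → (if does (i ≟ j) then 1 else 0) ≡ 0
  off j j≢i with i ≟ j
  ... | yes i≡j = contradiction (≡.sym i≡j) j≢i
  ... | no _    = ≡.refl
  on : (if does (i ≟ i) then 1 else 0) ≡ 1
  on with i ≟ i
  ... | yes _  = ≡.refl
  ... | no i≢i = contradiction ≡.refl i≢i

-- Prepares the degree of `K`: the valences are gathered into one natural-number sum under `+`, the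
-- form to which double counting of edge ends applies.
sum-υ-2+2q : ∀ {n} (υ q : Fin n → ℕ) →
  ℤΣ.sum (λ p → + υ p ℤ.- + 2 ℤ.+ + 2 ℤ.* + q p)
  ≡ + ℕΣ.sum υ ℤ.- + 2 ℤ.* + n ℤ.+ + 2 ℤ.* ℤΣ.sum (λ p → + q p)
sum-υ-2+2q {ℕ.zero}  υ q = ≡.refl
sum-υ-2+2q {ℕ.suc n} υ q = ≡.trans
  (≡.cong (λ s → + υ zero ℤ.- + 2 ℤ.+ + 2 ℤ.* + q zero ℤ.+ s) (sum-υ-2+2q (υ ∘ suc) (q ∘ suc)))
  (≡.trans (rearrange (+ υ zero) (+ q zero) (+ ℕΣ.sum (υ ∘ suc)) (+ n) (ℤΣ.sum (λ p → + q (suc p))))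
    (≡.cong₂ (λ a b → a ℤ.- + 2 ℤ.* b ℤ.+ + 2 ℤ.* ℤΣ.sum (λ p → + q p))
      (≡.sym (ℤ.pos-+ (υ zero) _)) (≡.sym (ℤ.pos-+ 1 n))))
  where
  rearrange : ∀ a b s m t →
    a ℤ.- + 2 ℤ.+ + 2 ℤ.* b ℤ.+ (s ℤ.- + 2 ℤ.* m ℤ.+ + 2 ℤ.* t)
    ≡ (a ℤ.+ s) ℤ.- + 2 ℤ.* (+ 1 ℤ.+ m) ℤ.+ + 2 ℤ.* (b ℤ.+ t)
  rearrange = solve-∀

-- Differences and products of finite sums in a commutative ring.

module Sums {c ℓ} (R : CommutativeRing c ℓ) where
  open CommutativeRing R
  open SemiringSum semiring
  open RingProperties ring

  sum-neg : ∀ {n} (f : Fin n → Carrier) → ∑[ i < n ] (- f i) ≈ - ∑[ i < n ] f i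
  sum-neg f = trans (sum-cong-≋ (λ i → sym (-1*x≈-x (f i))))
    (trans (sym (*-distribˡ-sum (- 1#) f)) (-1*x≈-x _))

  sum-sub : ∀ {n} (f g : Fin n → Carrier) →
    ∑[ i < n ] (f i - g i) ≈ ∑[ i < n ] f i - ∑[ i < n ] g i
  sum-sub f g = trans (∑-distrib-+ f (λ i → - g i)) (+-congˡ (sum-neg g))

  sum-product : ∀ {m n} (f : Fin m → Carrier) (g : Fin n → Carrier) →
    ∑[ i < m ] ∑[ j < n ] (f i * g j) ≈ sum f * sum g
  sum-product f g = trans (sum-cong-≋ λ i → sym (*-distribˡ-sum (f i) g))
    (sym (*-distribʳ-sum (sum g) f))

-- Bilinear forms and Moore-Penrose inverses.

module PseudoInverse {c ℓ₁ ℓ₂ ℓ₃} (F : OrderedField c ℓ₁ ℓ₂ ℓ₃) where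
  open Metrized F
  private
    R : CommutativeRing c ℓ₁
    R = OrderedField.commutativeRing F
  open CommutativeRing R
    hiding (Carrier; _≈_; _+_; _*_; -_; _-_; 0#; 1#)
  open SemiringSum semiring using (sum-cong-≋; ∑-distrib-+; ∑-comm; *-distribˡ-sum; *-distribʳ-sum)
  open SupportedSum +-commutativeMonoid
  open SetoidReasoning setoid

  infix 7 _∙_
  infixr 8 _·_

  _∙_ : ∀ {n} (u w : Fin n → Carrier) → Carrier
  _∙_ {n} u w = ∑[ i < n ] (u i * w i)

  _·_ : ∀ {m n} → Matrix m n → (Fin n → Carrier) → Fin m → Carrier
  (A · x) i = A i ∙ x

  ∙-congˡ : ∀ {n} (u : Fin n → Carrier) {w w′} → (∀ i → w i ≈ w′ i) → u ∙ w ≈ u ∙ w′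
  ∙-congˡ u w≈w′ = sum-cong-≋ λ i → *-congˡ (w≈w′ i)

  ∙-congʳ : ∀ {n} (w : Fin n → Carrier) {u u′} → (∀ i → u i ≈ u′ i) → u ∙ w ≈ u′ ∙ w
  ∙-congʳ w u≈u′ = sum-cong-≋ λ i → *-congʳ (u≈u′ i)

  ∙-comm : ∀ {n} (u w : Fin n → Carrier) → u ∙ w ≈ w ∙ u
  ∙-comm u w = sum-cong-≋ λ i → *-comm (u i) (w i)

  ∙-distribˡ-+ : ∀ {n} (u w w′ : Fin n → Carrier) → u ∙ (λ i → w i + w′ i) ≈ u ∙ w + u ∙ w′
  ∙-distribˡ-+ u w w′ = trans (sum-cong-≋ λ i → distribˡ (u i) (w i) (w′ i))
    (∑-distrib-+ (λ i → u i * w i) (λ i → u i * w′ i))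

  ∙-zeroʳ : ∀ {n} (u : Fin n → Carrier) {w} → (∀ i → w i ≈ 0#) → u ∙ w ≈ 0#
  ∙-zeroʳ u w≈0 = sum-zero λ i → trans (*-congˡ (w≈0 i)) (zeroʳ (u i))

  ∙-zeroˡ : ∀ {n} {u : Fin n → Carrier} w → (∀ i → u i ≈ 0#) → u ∙ w ≈ 0#
  ∙-zeroˡ w u≈0 = trans (∙-comm _ w) (∙-zeroʳ w u≈0)

  -- Both sides are the double sum of `u i * A i j * w j`, taken in the two orders of summation.
  ∙-adjoint : ∀ {m n} (A : Matrix m n) u w → u ∙ (A · w) ≈ (flip A · u) ∙ w
  ∙-adjoint A u w = begin
    u ∙ (A · w)
      ≈⟨ (sum-cong-≋ λ i → *-distribˡ-sum (u i) (λ j → A i j * w j)) ⟩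
    sum (λ i → sum λ j → u i * (A i j * w j))
      ≈⟨ ∑-comm (λ i j → u i * (A i j * w j)) ⟩
    sum (λ j → sum λ i → u i * (A i j * w j))
      ≈⟨ (sum-cong-≋ λ j → sum-cong-≋ λ i → trans (sym (*-assoc (u i) (A i j) (w j))) (*-congʳ (*-comm (u i) (A i j)))) ⟩
    sum (λ j → sum λ i → A i j * u i * w j)
      ≈⟨ (sum-cong-≋ λ j → *-distribʳ-sum (w j) (λ i → A i j * u i)) ⟨
    (flip A · u) ∙ w ∎

  -- Row `i` of `A ⊗ B` is the transpose of `B` applied to row `i` of `A`, which makes this an
  -- instance of `∙-adjoint`.
  ⊗-· : ∀ {l m n} (A : Matrix l m) (B : Matrix m n) x i → ((A ⊗ B) · x) i ≈ (A · B · x) i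
  ⊗-· A B x i = sym (trans (∙-adjoint B (A i) x)
    (∙-congʳ x λ k → ∙-comm (flip B k) (A i)))

  flip-⊗-· : ∀ {l m n} (A : Matrix l m) (B : Matrix m n) x i →
    (flip (A ⊗ B) · x) i ≈ (flip B · flip A · x) i
  flip-⊗-· A B x i = trans
    (∙-congʳ x λ k → ∙-comm (A k) (flip B i))
    (⊗-· (flip B) (flip A) x i)

  module _ {m n} {A : Matrix m n} {A⁺ : Matrix n m} (mp : IsMoorePenroseInverse A A⁺) where
    open IsMoorePenroseInverse mp

    -- In A⁺ = A⁺(AA⁺), the symmetric factor AA⁺ equals its transpose (A⁺)ᵀAᵀ, so Aᵀ acts first on
    -- `x`.
    pseudoInverse-annihilates : ∀ x → (∀ i → (flip A · x) i ≈ 0#) → ∀ i → (A⁺ · x) i ≈ 0#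
    pseudoInverse-annihilates x Aᵀx≈0 i = begin
      (A⁺ · x) i                   ≈⟨ ∙-congʳ x (A⁺AA⁺≈A⁺ i) ⟨
      ((A⁺ ⊗ A ⊗ A⁺) · x) i        ≈⟨ ⊗-· (A⁺ ⊗ A) A⁺ x i ⟩
      ((A⁺ ⊗ A) · A⁺ · x) i        ≈⟨ ⊗-· A⁺ A (A⁺ · x) i ⟩
      (A⁺ · A · A⁺ · x) i          ≈⟨ ∙-zeroʳ (A⁺ i) AA⁺x≈0 ⟩
      0#                           ∎
      where
      AA⁺x≈0 : ∀ j → (A · A⁺ · x) j ≈ 0#
      AA⁺x≈0 j = begin
        (A · A⁺ · x) j             ≈⟨ ⊗-· A A⁺ x j ⟨
        ((A ⊗ A⁺) · x) j           ≈⟨ ∙-congʳ x (AA⁺-symmetric j) ⟨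
        (flip (A ⊗ A⁺) · x) j      ≈⟨ flip-⊗-· A A⁺ x j ⟩
        (flip A⁺ · flip A · x) j   ≈⟨ ∙-zeroʳ (flip A⁺ j) Aᵀx≈0 ⟩
        0#                         ∎

    -- The range of A⁺ is orthogonal to the kernel of A: in A⁺ = (A⁺A)A⁺ the symmetric factor A⁺A
    -- can be moved onto `x`, where A acts first.
    pseudoInverse-range : ∀ x → (∀ i → (A · x) i ≈ 0#) → ∀ w → x ∙ (A⁺ · w) ≈ 0#
    pseudoInverse-range x Ax≈0 w = begin
      x ∙ (A⁺ · w)                          ≈⟨ ∙-congˡ x (λ i → ∙-congʳ w (A⁺AA⁺≈A⁺ i)) ⟨
      x ∙ ((A⁺ ⊗ A ⊗ A⁺) · w)               ≈⟨ ∙-congˡ x (⊗-· (A⁺ ⊗ A) A⁺ w) ⟩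
      x ∙ ((A⁺ ⊗ A) · A⁺ · w)               ≈⟨ ∙-adjoint (A⁺ ⊗ A) x (A⁺ · w) ⟩
      (flip (A⁺ ⊗ A) · x) ∙ (A⁺ · w)        ≈⟨ ∙-zeroˡ (A⁺ · w) zeros ⟩
      0#                                    ∎
      where
      zeros : ∀ i → (flip (A⁺ ⊗ A) · x) i ≈ 0#
      zeros i = begin
        (flip (A⁺ ⊗ A) · x) i   ≈⟨ ∙-congʳ x (A⁺A-symmetric i) ⟩
        ((A⁺ ⊗ A) · x) i        ≈⟨ ⊗-· A⁺ A x i ⟩
        (A⁺ · A · x) i          ≈⟨ ∙-zeroʳ (A⁺ i) Ax≈0 ⟩
        0#                      ∎

  module _ {n} {A A⁺ : Matrix n n} (mp : IsMoorePenroseInverse A A⁺) (A-symmetric : flip A ≈ᴹ A) where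
    open IsMoorePenroseInverse mp

    -- Since AA⁺A = A, the pairing φᵀAφ can be opened around A⁺; symmetry of A then turns the left
    -- factor into Aφ as well. The value therefore depends on `d` alone and not on the solution `φ`.
    energy≈pseudoInverse-form : ∀ φ d → (∀ i → (A · φ) i ≈ d i) → d ∙ φ ≈ d ∙ (A⁺ · d)
    energy≈pseudoInverse-form φ d Aφ≈d = begin
      d ∙ φ                            ≈⟨ ∙-comm d φ ⟩
      φ ∙ d                            ≈⟨ ∙-congˡ φ Aφ≈d ⟨
      φ ∙ (A · φ)                      ≈⟨ ∙-congˡ φ (λ i → ∙-congʳ φ (AA⁺A≈A i)) ⟨
      φ ∙ ((A ⊗ A⁺ ⊗ A) · φ)           ≈⟨ ∙-congˡ φ (⊗-· (A ⊗ A⁺) A φ) ⟩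
      φ ∙ ((A ⊗ A⁺) · A · φ)           ≈⟨ ∙-congˡ φ (⊗-· A A⁺ (A · φ)) ⟩
      φ ∙ (A · A⁺ · A · φ)             ≈⟨ ∙-adjoint A φ (A⁺ · A · φ) ⟩
      (flip A · φ) ∙ (A⁺ · A · φ)      ≈⟨ ∙-congʳ _ (λ i → trans (∙-congʳ φ (A-symmetric i)) (Aφ≈d i)) ⟩
      d ∙ (A⁺ · A · φ)                 ≈⟨ ∙-congˡ d (λ i → ∙-congˡ (A⁺ i) Aφ≈d) ⟩
      d ∙ (A⁺ · d)                     ∎

  -- In the bilinear expansion every term other than uᵀBu contains Bz or zᵀB. One condition for each
  -- side is stated, as `B` is an arbitrary square matrix.
  form-translate : ∀ {n} (B : Matrix n n) {z} →
    (∀ i → (B · z) i ≈ 0#) → (∀ w → z ∙ (B · w) ≈ 0#) →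
    ∀ u → (λ i → u i + z i) ∙ (B · λ i → u i + z i) ≈ u ∙ (B · u)
  form-translate B {z} Bz≈0 zB≈0 u = begin
    u+z ∙ (B · u+z)                    ≈⟨ ∙-comm u+z (B · u+z) ⟩
    (B · u+z) ∙ u+z                    ≈⟨ ∙-distribˡ-+ (B · u+z) u z ⟩
    (B · u+z) ∙ u + (B · u+z) ∙ z      ≈⟨ +-congˡ (trans (∙-comm (B · u+z) z) (zB≈0 u+z)) ⟩
    (B · u+z) ∙ u + 0#                 ≈⟨ +-identityʳ _ ⟩
    (B · u+z) ∙ u                      ≈⟨ ∙-comm (B · u+z) u ⟩
    u ∙ (B · u+z)                      ≈⟨ ∙-congˡ u (λ i → begin
      (B · u+z) i                        ≈⟨ ∙-distribˡ-+ (B i) u z ⟩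
      (B · u) i + (B · z) i              ≈⟨ +-congˡ (Bz≈0 i) ⟩
      (B · u) i + 0#                     ≈⟨ +-identityʳ _ ⟩
      (B · u) i                          ∎) ⟩
    u ∙ (B · u)                        ∎
    where u+z = λ i → u i + z i

-- Delta vectors, edge incidence and conductances.

module Laplacian {c ℓ₁ ℓ₂ ℓ₃} (F : OrderedField c ℓ₁ ℓ₂ ℓ₃) (Γ : Metrized.MetrizedGraph F) where
  open Metrized F
  open MetrizedGraph Γ
  private
    R : CommutativeRing c ℓ₁
    R = OrderedField.commutativeRing F
  open CommutativeRing R
    hiding (Carrier; _≈_; _+_; _*_; -_; _-_; 0#; 1#)
  open SemiringSum semiring using (sum-cong-≋; ∑-distrib-+; *-distribˡ-sum; *-distribʳ-sum)
  open SupportedSum +-commutativeMonoid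
  open Sums R
  open RingProperties ring
  open CommutativeSemigroupProperties +-commutativeSemigroup using (interchange)
  open PseudoInverse F
  open SetoidReasoning setoid

  δ-≡ : ∀ x → δ x x ≈ 1#
  δ-≡ x with x ≟ x
  ... | yes _  = refl
  ... | no x≢x = contradiction ≡.refl x≢x

  δ-≢ : ∀ {x p} → x ≢ p → δ x p ≈ 0#
  δ-≢ {x} {p} x≢p with x ≟ p
  ... | yes x≡p = contradiction x≡p x≢p
  ... | no _    = refl

  δ-sym : ∀ x p → δ x p ≈ δ p x
  δ-sym x p with x ≟ p
  ... | yes ≡.refl = sym (δ-≡ x)
  ... | no x≢p     = sym (δ-≢ (x≢p ∘ ≡.sym))

  -- Where the delta does not vanish the two vertices coincide. This trades a value at a row vertex
  -- for the value at an end of an edge.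
  δ-subst : ∀ x p (f : Fin v → Carrier) → δ x p * f p ≈ δ x p * f x
  δ-subst x p f with x ≟ p
  ... | yes ≡.refl = refl
  ... | no _       = trans (zeroˡ _) (sym (zeroˡ _))

  δ-∙ : ∀ x w → δ x ∙ w ≈ w x
  δ-∙ x w = trans (sum-single (λ p → δ x p * w p) x λ p p≢x → trans (*-congʳ (δ-≢ (p≢x ∘ ≡.sym))) (zeroˡ _))
    (trans (*-congʳ (δ-≡ x)) (*-identityˡ _))

  [δ-δ]-∙ : ∀ x y w → (λ p → δ x p - δ y p) ∙ w ≈ w x - w y
  [δ-δ]-∙ x y w = begin
    (λ p → δ x p - δ y p) ∙ w    ≈⟨ (sum-cong-≋ λ p → [y-z]x≈yx-zx (w p) (δ x p) (δ y p)) ⟩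
    sum (λ p → δ x p * w p - δ y p * w p)
                                 ≈⟨ sum-sub (λ p → δ x p * w p) (λ p → δ y p * w p) ⟩
    δ x ∙ w - δ y ∙ w            ≈⟨ +-cong (δ-∙ x w) (-‿cong (δ-∙ y w)) ⟩
    w x - w y                    ∎

  if-δ : ∀ x p z → (if does (x ≟ p) then z else 0#) ≈ δ x p * z
  if-δ x p z with x ≟ p
  ... | yes _ = sym (*-identityˡ z)
  ... | no _  = sym (zeroˡ z)

  δ*δ≈0 : ∀ {x y p q} → ¬ (x ≡ p × y ≡ q) → δ x p * δ y q ≈ 0#
  δ*δ≈0 {x} {y} {p} {q} ≢ with x ≟ p
  ... | yes x≡p = trans (*-congˡ (δ-≢ λ y≡q → ≢ (x≡p , y≡q))) (zeroʳ _)
  ... | no _    = zeroˡ _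

  -- Without self-loops, incidence p k s is 1 or 0 according as edge k joins p and s.
  incidence : Fin v → Matrix e v
  incidence p k s = δ (src k) p * δ (tgt k) s + δ (tgt k) p * δ (src k) s

  -- An edge that is not a loop joins `p` and `s` in one orientation only, so exactly one summand is
  -- 1; a loop would give 2.
  incidence-joins : ∀ {k p s} → src k ≢ tgt k → Joins k p s → incidence p k s ≈ 1#
  incidence-joins {k} s≢t (inj₁ (≡.refl , ≡.refl)) = trans
    (+-cong (trans (*-cong (δ-≡ (src k)) (δ-≡ (tgt k))) (*-identityˡ 1#))
      (trans (*-congʳ (δ-≢ (s≢t ∘ ≡.sym))) (zeroˡ _)))
    (+-identityʳ 1#)
  incidence-joins {k} s≢t (inj₂ (≡.refl , ≡.refl)) = trans
    (+-cong (trans (*-congʳ (δ-≢ s≢t)) (zeroˡ _))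
      (trans (*-cong (δ-≡ (tgt k)) (δ-≡ (src k))) (*-identityˡ 1#)))
    (+-identityˡ 1#)

  incidence-¬joins : ∀ {k p s} → ¬ Joins k p s → incidence p k s ≈ 0#
  incidence-¬joins ¬J = trans
    (+-cong (δ*δ≈0 λ (a , b) → ¬J (inj₁ (a , b))) (δ*δ≈0 λ (a , b) → ¬J (inj₂ (b , a))))
    (+-identityˡ 0#)

  incidence-sym : ∀ p k s → incidence p k s ≈ incidence s k p
  incidence-sym p k s = trans (+-comm _ _) (+-cong (*-comm _ _) (*-comm _ _))

  -- The deltas collapse the sum over the second vertex: each end of `k` lying at `p` contributes
  -- the value of `f` at the opposite end.
  incidence-· : ∀ p f k → (incidence p · f) k ≈ δ (src k) p * f (tgt k) + δ (tgt k) p * f (src k)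
  incidence-· p f k = begin
    (incidence p · f) k
      ≈⟨ (sum-cong-≋ λ s → trans (distribʳ (f s) (a * δ (tgt k) s) (b * δ (src k) s))
           (+-cong (*-assoc a (δ (tgt k) s) (f s)) (*-assoc b (δ (src k) s) (f s)))) ⟩
    sum (λ s → a * (δ (tgt k) s * f s) + b * (δ (src k) s * f s))
      ≈⟨ ∑-distrib-+ (λ s → a * (δ (tgt k) s * f s)) (λ s → b * (δ (src k) s * f s)) ⟩
    sum (λ s → a * (δ (tgt k) s * f s)) + sum (λ s → b * (δ (src k) s * f s))
      ≈⟨ +-cong (*-distribˡ-sum a (λ s → δ (tgt k) s * f s)) (*-distribˡ-sum b (λ s → δ (src k) s * f s)) ⟨
    a * (δ (tgt k) ∙ f) + b * (δ (src k) ∙ f)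
      ≈⟨ +-cong (*-congˡ (δ-∙ (tgt k) f)) (*-congˡ (δ-∙ (src k) f)) ⟩
    a * f (tgt k) + b * f (src k) ∎
    where
    a = δ (src k) p
    b = δ (tgt k) p

  -- In a loopless graph this is the total conductance between two vertices. Being a sum over all
  -- edges, unlike the edge picked by `any?`, it allows edge and vertex sums to be exchanged.
  weight : Fin v → Fin v → Carrier
  weight p = flip (incidence p) · 1/len

  -- The row sum is written as a pairing with the constant 1 so that `weight-∙` also applies to it.
  degree : Fin v → Carrier
  degree p = weight p ∙ λ _ → 1#

  weight-sym : ∀ p s → weight p s ≈ weight s p
  weight-sym p s = ∙-congʳ 1/len λ k → incidence-sym p k s

  -- Converts a sum over neighbouring vertices into a sum over edges, the shape of `netOutflow`.
  weight-∙ : ∀ p f → weight p ∙ f ≈ (λ k → δ (src k) p * f (tgt k) + δ (tgt k) p * f (src k)) ∙ 1/len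
  weight-∙ p f = begin
    weight p ∙ f                 ≈⟨ ∙-comm (weight p) f ⟩
    f ∙ weight p                 ≈⟨ ∙-adjoint (flip (incidence p)) f 1/len ⟩
    (incidence p · f) ∙ 1/len    ≈⟨ ∙-congʳ 1/len (incidence-· p f) ⟩
    (λ k → δ (src k) p * f (tgt k) + δ (tgt k) p * f (src k)) ∙ 1/len ∎

  -- The Laplacian of an adequate vertex set, and effective resistance.

  module _ (adequate : Adequate) where
    private
      loopless : ∀ k → src k ≢ tgt k
      loopless = proj₁ adequate
      simple : ∀ k l p q → Joins k p q → Joins l p q → k ≡ l
      simple = proj₂ adequate

    -- As there are no multiple edges, the edge found by `any?` is the only one with nonzero
    -- incidence, and as there are no loops that incidence is 1. If no edge is found, every term of
    -- the weight vanishes.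
    offDiagonal≈-weight : ∀ p s → offDiagonal p s ≈ - weight p s
    offDiagonal≈-weight p s with any? (λ k → joins? k p s)
    ... | yes (k , J) = -‿cong (sym (begin
      weight p s
        ≈⟨ sum-single (λ l → incidence p l s * 1/len l) k (λ l l≢k → trans
             (*-congʳ (incidence-¬joins λ J′ → l≢k (simple l k p s J′ J))) (zeroˡ (1/len l))) ⟩
      incidence p k s * 1/len k    ≈⟨ *-congʳ (incidence-joins (loopless k) J) ⟩
      1# * 1/len k                 ≈⟨ *-identityˡ (1/len k) ⟩
      1/len k                      ∎))
    ... | no ¬J = sym (trans
      (-‿cong (∙-zeroˡ 1/len λ k → incidence-¬joins λ J → ¬J (k , J)))
      -0#≈0#)

    -- An edge joining `p` to itself, in either orientation, would be a loop.
    weight-diagonal : ∀ p → weight p p ≈ 0#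
    weight-diagonal p = ∙-zeroˡ 1/len λ k → incidence-¬joins λ where
      (inj₁ (s≡p , t≡p)) → loopless k (≡.trans s≡p (≡.sym t≡p))
      (inj₂ (s≡p , t≡p)) → loopless k (≡.trans s≡p (≡.sym t≡p))

    -- weight p p ≈ 0#, so subtracting it on the diagonal is harmless.
    laplacian≈ : ∀ p q → discreteLaplacian p q ≈ δ p q * degree p - weight p q
    laplacian≈ p q with p ≟ q
    ... | no _ = trans (offDiagonal≈-weight p q)
      (sym (trans (+-congʳ (zeroˡ (degree p))) (+-identityˡ _)))
    ... | yes ≡.refl = begin
      - (∑[ s < v ] (if does (p ≟ s) then 0# else offDiagonal p s))
                                   ≈⟨ -‿cong (sum-cong-≋ punctured) ⟩
      - (∑[ s < v ] (- weight p s))  ≈⟨ -‿cong (sum-neg (weight p)) ⟩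
      - - sum (weight p)           ≈⟨ -‿involutive (sum (weight p)) ⟩
      sum (weight p)               ≈⟨ (sum-cong-≋ λ s → *-identityʳ (weight p s)) ⟨
      degree p                     ≈⟨ *-identityˡ (degree p) ⟨
      1# * degree p                ≈⟨ +-identityʳ _ ⟨
      1# * degree p + 0#           ≈⟨ +-congˡ (trans (-‿cong (weight-diagonal p)) -0#≈0#) ⟨
      1# * degree p - weight p p   ∎
      where
      punctured : ∀ s → (if does (p ≟ s) then 0# else offDiagonal p s) ≈ - weight p s
      punctured s with p ≟ s
      ... | yes ≡.refl = sym (trans (-‿cong (weight-diagonal p)) -0#≈0#)
      ... | no _       = offDiagonal≈-weight p s

    -- Conductances do not depend on the order of the two vertices, and in the diagonal term the
    -- delta lets the degree be read at either index.
    laplacian-symmetric : flip discreteLaplacian ≈ᴹ discreteLaplacian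
    laplacian-symmetric p q = begin
      discreteLaplacian q p                  ≈⟨ laplacian≈ q p ⟩
      δ q p * degree q - weight q p          ≈⟨ +-cong swap (-‿cong (weight-sym q p)) ⟩
      δ p q * degree p - weight p q          ≈⟨ laplacian≈ p q ⟨
      discreteLaplacian p q                  ∎
      where
      swap : δ q p * degree q ≈ δ p q * degree p
      swap = trans (sym (δ-subst q p degree)) (*-congʳ (δ-sym q p))

    -- Once `weight-∙` has turned the degree and the weights into edge sums, the two sides agree
    -- edge by edge. Kirchhoff's law for a unit current thus becomes Lφ = δₓ - δᵧ.
    laplacian-netOutflow : ∀ φ p → (discreteLaplacian · φ) p ≈ netOutflow φ p
    laplacian-netOutflow φ p = begin
      (discreteLaplacian · φ) p
        ≈⟨ (sum-cong-≋ λ s → trans (*-congʳ (laplacian≈ p s))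
             (trans ([y-z]x≈yx-zx (φ s) (δ p s * degree p) (weight p s))
               (+-congʳ (*-assoc (δ p s) (degree p) (φ s))))) ⟩
      sum (λ s → δ p s * (degree p * φ s) - weight p s * φ s)
        ≈⟨ sum-sub (λ s → δ p s * (degree p * φ s)) (λ s → weight p s * φ s) ⟩
      δ p ∙ (λ s → degree p * φ s) - weight p ∙ φ
        ≈⟨ +-cong (trans (δ-∙ p (λ s → degree p * φ s)) (trans (*-congʳ (weight-∙ p λ _ → 1#))
             (*-distribʳ-sum (φ p) (λ k → (a k * 1# + b k * 1#) * 1/len k))))
             (-‿cong (weight-∙ p φ)) ⟩
      sum (λ k → (a k * 1# + b k * 1#) * 1/len k * φ p)
        - sum (λ k → (a k * φ (tgt k) + b k * φ (src k)) * 1/len k)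
        ≈⟨ sum-sub (λ k → (a k * 1# + b k * 1#) * 1/len k * φ p)
             (λ k → (a k * φ (tgt k) + b k * φ (src k)) * 1/len k) ⟨
      sum (λ k → (a k * 1# + b k * 1#) * 1/len k * φ p
                 - (a k * φ (tgt k) + b k * φ (src k)) * 1/len k)
        ≈⟨ sum-cong-≋ ohm ⟩
      netOutflow φ p ∎
      where
      a b : Fin e → Carrier
      a k = δ (src k) p
      b k = δ (tgt k) p

      -- Only ends of `k` at `p` count. For each of them `φ p` is the potential at that end, which
      -- leaves the drop `s - t` for the source and `t - s` for the target: the current leaves at
      -- the one and enters at the other.
      ohm : ∀ k → (a k * 1# + b k * 1#) * 1/len k * φ p - (a k * φ (tgt k) + b k * φ (src k)) * 1/len k
            ≈ (if does (src k ≟ p) then current φ k else 0#) - (if does (tgt k ≟ p) then current φ k else 0#)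
      ohm k = begin
        (α * 1# + β * 1#) * y * φ p - (α * t + β * s) * y
          ≈⟨ +-congʳ (trans (*-congʳ (*-congʳ (+-cong (*-identityʳ α) (*-identityʳ β))))
               (trans (*-assoc (α + β) y (φ p)) (trans (*-congˡ (*-comm y (φ p))) (sym (*-assoc (α + β) (φ p) y))))) ⟩
        (α + β) * φ p * y - (α * t + β * s) * y
          -- The factor `φ p` becomes `s` beside `α` and `t` beside `β`, since each delta forces `p`
          -- to be that end.
          ≈⟨ +-congʳ (*-congʳ (trans (distribʳ (φ p) α β) (+-cong (δ-subst (src k) p φ) (δ-subst (tgt k) p φ)))) ⟩
        (α * s + β * t) * y - (α * t + β * s) * y
          ≈⟨ [y-z]x≈yx-zx y (α * s + β * t) (α * t + β * s) ⟨
        ((α * s + β * t) - (α * t + β * s)) * y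
          ≈⟨ *-congʳ (+-congˡ (-‿+-comm (α * t) (β * s))) ⟨
        ((α * s + β * t) + (- (α * t) - β * s)) * y
          ≈⟨ *-congʳ (interchange (α * s) (β * t) (- (α * t)) (- (β * s))) ⟩
        ((α * s - α * t) + (β * t - β * s)) * y
          ≈⟨ *-congʳ (+-cong (x[y-z]≈xy-xz α s t) (trans (-‿cong (x[y-z]≈xy-xz β s t)) (⁻¹-anti-homo‿- (β * s) (β * t)))) ⟨
        (α * (s - t) - β * (s - t)) * y
          ≈⟨ [y-z]x≈yx-zx y (α * (s - t)) (β * (s - t)) ⟩
        α * (s - t) * y - β * (s - t) * y
          ≈⟨ +-cong (*-assoc α (s - t) y) (-‿cong (*-assoc β (s - t) y)) ⟩
        α * current φ k - β * current φ k
          ≈⟨ +-cong (if-δ (src k) p (current φ k)) (-‿cong (if-δ (tgt k) p (current φ k))) ⟨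
        _ ∎
        where
        α = a k
        β = b k
        y = 1/len k
        s = φ (src k)
        t = φ (tgt k)

    -- A constant potential drives no current through any edge.
    laplacian-constant : ∀ z p → (discreteLaplacian · λ _ → z) p ≈ 0#
    laplacian-constant z p = trans (laplacian-netOutflow (λ _ → z) p)
      (sum-zero λ k → trans
        (+-cong (trans (if-δ (src k) p (0ᶜ k)) (trans (*-congˡ (0ᶜ≈0 k)) (zeroʳ _)))
          (-‿cong (trans (if-δ (tgt k) p (0ᶜ k)) (trans (*-congˡ (0ᶜ≈0 k)) (zeroʳ _)))))
        (-‿inverseʳ 0#))
      where
      0ᶜ : Fin e → Carrier
      0ᶜ = current λ _ → z
      0ᶜ≈0 : ∀ k → 0ᶜ k ≈ 0#
      0ᶜ≈0 k = trans (*-congʳ (-‿inverseʳ z)) (zeroˡ (1/len k))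

    -- Pairing with `d` takes the difference of the values at `x` and `y`. It is used for the
    -- potential drop first, then on each side of `L⁺`, which yields the four entries.
    resistance≈ : ∀ {r L⁺} → IsResistanceFunction r → IsMoorePenroseInverse discreteLaplacian L⁺ →
      ∀ x y → r x y ≈ (L⁺ x x - L⁺ x y) - (L⁺ y x - L⁺ y y)
    resistance≈ {r} {L⁺} isR mp x y with isR x y
    ... | φ , potential , r≈ = begin
      r x y                  ≈⟨ r≈ ⟩
      φ x - φ y              ≈⟨ [δ-δ]-∙ x y φ ⟨
      d ∙ φ                  ≈⟨ energy≈pseudoInverse-form mp laplacian-symmetric φ d
                                  (λ p → trans (laplacian-netOutflow φ p) (potential p)) ⟩
      d ∙ (L⁺ · d)           ≈⟨ [δ-δ]-∙ x y (L⁺ · d) ⟩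
      (L⁺ · d) x - (L⁺ · d) y  ≈⟨ +-cong (column x) (-‿cong (column y)) ⟩
      (L⁺ x x - L⁺ x y) - (L⁺ y x - L⁺ y y) ∎
      where
      d : Fin v → Carrier
      d p = δ x p - δ y p
      column : ∀ p → (L⁺ · d) p ≈ L⁺ p x - L⁺ p y
      column p = trans (∙-comm (L⁺ p) d) ([δ-δ]-∙ x y (L⁺ p))

-- The additive embedding of the integers into the field.

module IntegerEmbedding {c ℓ₁ ℓ₂ ℓ₃} (F : OrderedField c ℓ₁ ℓ₂ ℓ₃) where
  open Metrized F
  private
    R : CommutativeRing c ℓ₁
    R = OrderedField.commutativeRing F
  open CommutativeRing R
    hiding (Carrier; _≈_; _+_; _*_; -_; _-_; 0#; 1#; zero)
  open RingProperties ring
  open CommutativeSemigroupProperties +-commutativeSemigroup using (interchange)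
  open MonoidMult +-monoid using (×-homo-+)
  open SetoidReasoning setoid

  -- Integer addition with mixed signs is a `⊖`. Each step cancels a unit from both arguments, and
  -- the field restores it as `1# - 1#`.
  fromℤ-⊖ : ∀ m n → fromℤ (m ℤ.⊖ n) ≈ fromℤ (+ m) - fromℤ (+ n)
  fromℤ-⊖ ℕ.zero    ℕ.zero    = sym (-‿inverseʳ 0#)
  fromℤ-⊖ ℕ.zero    (ℕ.suc n) = sym (+-identityˡ _)
  fromℤ-⊖ (ℕ.suc m) ℕ.zero    = sym (trans (+-congˡ -0#≈0#) (+-identityʳ _))
  fromℤ-⊖ (ℕ.suc m) (ℕ.suc n) = begin
    fromℤ (ℕ.suc m ℤ.⊖ ℕ.suc n)    ≡⟨ ≡.cong fromℤ (ℤ.[1+m]⊖[1+n]≡m⊖n m n) ⟩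
    fromℤ (m ℤ.⊖ n)                ≈⟨ fromℤ-⊖ m n ⟩
    a - b                          ≈⟨ +-identityˡ (a - b) ⟨
    0# + (a - b)                   ≈⟨ +-congʳ (-‿inverseʳ 1#) ⟨
    (1# - 1#) + (a - b)            ≈⟨ interchange 1# (- 1#) a (- b) ⟩
    (1# + a) + (- 1# - b)          ≈⟨ +-congˡ (-‿+-comm 1# b) ⟩
    (1# + a) - (1# + b)            ∎
    where
    a = fromℤ (+ m)
    b = fromℤ (+ n)

  fromℤ-+ : ∀ i j → fromℤ (i ℤ.+ j) ≈ fromℤ i + fromℤ j
  fromℤ-+ (+ m)      (+ n)      = ×-homo-+ 1# m n
  fromℤ-+ (+ m)      ℤ.-[1+ n ] = fromℤ-⊖ m (ℕ.suc n)
  fromℤ-+ ℤ.-[1+ m ] (+ n)      = trans (fromℤ-⊖ n (ℕ.suc m)) (+-comm _ _)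
  -- The sum of two negatives carries both successors in front, so one of them is first moved onto
  -- `n`.
  fromℤ-+ ℤ.-[1+ m ] ℤ.-[1+ n ] = begin
    - fromℤ (+ (ℕ.suc (ℕ.suc (m ℕ.+ n))))    ≡⟨ ≡.cong (λ k → - fromℤ (+ k)) (ℕ.+-suc (ℕ.suc m) n) ⟨
    - fromℤ (+ (ℕ.suc m ℕ.+ ℕ.suc n))        ≈⟨ -‿cong (×-homo-+ 1# (ℕ.suc m) (ℕ.suc n)) ⟩
    - (fromℤ (+ ℕ.suc m) + fromℤ (+ ℕ.suc n)) ≈⟨ -‿+-comm (fromℤ (+ ℕ.suc m)) (fromℤ (+ ℕ.suc n)) ⟨
    - fromℤ (+ ℕ.suc m) - fromℤ (+ ℕ.suc n)  ∎

  fromℤ-sum : ∀ {n} (f : Fin n → ℤ.ℤ) → fromℤ (ℤΣ.sum f) ≈ sum (λ i → fromℤ (f i))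
  fromℤ-sum {ℕ.zero}  f = refl
  fromℤ-sum {ℕ.suc n} f = trans (fromℤ-+ (f zero) _) (+-congˡ (fromℤ-sum (f ∘ suc)))

  -- Doubling is the one integer product to be carried across `fromℤ`, and it reduces to additivity.
  fromℤ-double : ∀ i → fromℤ (+ 2 ℤ.* i) ≈ fromℤ i + fromℤ i
  fromℤ-double i = trans (reflexive (≡.cong fromℤ (double i))) (fromℤ-+ i i)
    where
    double : ∀ i → + 2 ℤ.* i ≡ i ℤ.+ i
    double = solve-∀

-- The degree of the canonical divisor.

module Canonical {c ℓ₁ ℓ₂ ℓ₃} (F : OrderedField c ℓ₁ ℓ₂ ℓ₃) (G : Metrized.PMGraph F) where
  open Metrized.PMGraph G

  -- Double counting of edge ends: each edge has one source and one target, and a loop counts twice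
  -- at its vertex.
  handshake : ℕΣ.sum υ ≡ 2 ℕ.* e
  handshake = begin
    ℕΣ.sum υ                                  ≡⟨ ∑-comm (λ p k → s k p ℕ.+ t k p) ⟩
    ℕΣ.sum (λ k → ℕΣ.sum λ p → s k p ℕ.+ t k p)
                                              ≡⟨ sum-cong-≗ {e} (λ k → ≡.trans (∑-distrib-+ (s k) (t k))
                                                   (≡.cong₂ ℕ._+_ (sum-indicator (src k)) (sum-indicator (tgt k)))) ⟩
    ℕΣ.sum {e} (λ _ → 2)                      ≡⟨ sum-const e ⟩
    2 ℕ.* e                                   ∎
    where
    open ≡.≡-Reasoning
    open MonoidSum ℕ.+-0-commutativeMonoid using (∑-comm; ∑-distrib-+; sum-cong-≗)
    s t : Fin e → Fin v → ℕ
    s k p = if does (src k ≟ p) then 1 else 0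
    t k p = if does (tgt k ≟ p) then 1 else 0
    sum-const : ∀ n → ℕΣ.sum {n} (λ _ → 2) ≡ 2 ℕ.* n
    sum-const ℕ.zero    = ≡.refl
    sum-const (ℕ.suc n) = ≡.trans (≡.cong (2 ℕ.+_) (sum-const n)) (≡.sym (ℕ.*-suc 2 n))

  -- By `handshake` the valence part is 2e - 2v = 2g(Γ) - 2, and the sum of 2𝐪 raises g(Γ) to the
  -- genus ḡ.
  deg-K : ℤΣ.sum K ≡ + 2 ℤ.* genus ℤ.- + 2
  deg-K = ≡.trans (sum-υ-2+2q υ 𝐪) (≡.trans
    (≡.cong (λ d → d ℤ.- + 2 ℤ.* + v ℤ.+ + 2 ℤ.* ℤΣ.sum (λ p → + 𝐪 p))
      (≡.trans (≡.cong +_ handshake) (ℤ.pos-* 2 e)))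
    (rearrange (+ e) (+ v) (ℤΣ.sum λ p → + 𝐪 p)))
    where
    rearrange : ∀ a b s → + 2 ℤ.* a ℤ.- + 2 ℤ.* b ℤ.+ + 2 ℤ.* s ≡ + 2 ℤ.* (a ℤ.- b ℤ.+ + 1 ℤ.+ s) ℤ.- + 2
    rearrange = solve-∀

-- Assembly of the formula for θ.

theorem3p6 : ∀ {c ℓ₁ ℓ₂ ℓ₃} (F : OrderedField c ℓ₁ ℓ₂ ℓ₃) → let open Metrized F in
    (G : PMGraph) → let open PMGraph G in
    Adequate →
    (r : Fin v → Fin v → Carrier) → IsResistanceFunction r →
    (L⁺ : Matrix v v) → IsMoorePenroseInverse discreteLaplacian L⁺ →
    θ r ≈ fromℤ (+ 2 ℤ.* (+ 2 ℤ.* genus ℤ.- + 2))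
            * (∑[ p < v ] (fromℤ (+ υ p ℤ.- + 2 ℤ.+ + 2 ℤ.* + 𝐪 p) * L⁺ p p))
          - fromℤ (+ 2)
            * (∑[ p < v ] ∑[ q < v ]
                (fromℤ (+ υ p ℤ.+ + 2 ℤ.* + 𝐪 p) * fromℤ (+ υ q ℤ.+ + 2 ℤ.* + 𝐪 q) * L⁺ p q))
theorem3p6 F G adequate r isR L⁺ mp = begin
  θ r
    ≈⟨ (sum-cong-≋ λ p → sum-cong-≋ λ q → expand p q) ⟩
  sum (λ p → sum λ q → (m p * k q + k p * m q) - (k p * k q * L⁺ p q + k q * k p * L⁺ q p))
    ≈⟨ (sum-cong-≋ λ p → trans
         (sum-sub (λ q → m p * k q + k p * m q) (λ q → k p * k q * L⁺ p q + k q * k p * L⁺ q p))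
         (+-cong (∑-distrib-+ (λ q → m p * k q) (λ q → k p * m q))
           (-‿cong (∑-distrib-+ (λ q → k p * k q * L⁺ p q) (λ q → k q * k p * L⁺ q p))))) ⟩
  sum (λ p → (sum (λ q → m p * k q) + sum (λ q → k p * m q))
           - (sum (λ q → k p * k q * L⁺ p q) + sum (λ q → k q * k p * L⁺ q p)))
    ≈⟨ trans
         (sum-sub (λ p → sum (λ q → m p * k q) + sum (λ q → k p * m q))
           (λ p → sum (λ q → k p * k q * L⁺ p q) + sum (λ q → k q * k p * L⁺ q p)))
         (+-cong (∑-distrib-+ (λ p → sum (λ q → m p * k q)) (λ p → sum (λ q → k p * m q)))
           (-‿cong (∑-distrib-+ (λ p → sum (λ q → k p * k q * L⁺ p q)) (λ p → sum (λ q → k q * k p * L⁺ q p))))) ⟩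
  (sum (λ p → sum (λ q → m p * k q)) + sum (λ p → sum (λ q → k p * m q)))
    - (Q k + sum (λ p → sum (λ q → k q * k p * L⁺ q p)))
    -- Both diagonal double sums factor as `sum k * sum m`, and exchanging the order of summation
    -- makes the transposed sum `Q k` again.
    ≈⟨ +-cong
         (trans (+-cong (trans (sum-product m k) (*-comm (sum m) (sum k))) (sum-product k m))
           (sym (distribʳ (sum m) (sum k) (sum k))))
         (-‿cong (+-congˡ (∑-comm (λ p q → k q * k p * L⁺ q p)))) ⟩
  (sum k + sum k) * sum m - (Q k + Q k)
    ≈⟨ +-cong (*-congʳ 2deg) (-‿cong 2Q) ⟩
  _ ∎
  where
  open Metrized F
  open PMGraph G
  open CommutativeRing (OrderedField.commutativeRing F)
    hiding (Carrier; _≈_; _+_; _*_; -_; _-_; 0#; 1#)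
  open SemiringSum semiring using (sum-cong-≋; ∑-distrib-+; ∑-comm; *-distribˡ-sum)
  open Sums (OrderedField.commutativeRing F)
  open RingProperties ring
  open CommutativeSemigroupProperties +-commutativeSemigroup using (interchange)
  open PseudoInverse F
  open Laplacian F Γ
  open IntegerEmbedding F
  open Canonical F G
  open SetoidReasoning setoid

  k a m : Fin v → Carrier
  k p = fromℤ (K p)
  a p = fromℤ (+ υ p ℤ.+ + 2 ℤ.* + 𝐪 p)
  m p = k p * L⁺ p p

  Q : (Fin v → Carrier) → Carrier
  Q u = ∑[ p < v ] ∑[ q < v ] (u p * u q * L⁺ p q)

  Q≈form : ∀ u → Q u ≈ u ∙ (L⁺ · u)
  Q≈form u = sum-cong-≋ λ p → trans
    (sum-cong-≋ λ q → trans (*-assoc (u p) (u q) (L⁺ p q)) (*-congˡ (*-comm (u q) (L⁺ p q))))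
    (sym (*-distribˡ-sum (u p) λ q → L⁺ p q * u q))

  -- The two coefficient vectors differ by the same constant at every vertex, a vector in the kernel
  -- of L.
  a≈k+2 : ∀ p → a p ≈ k p + fromℤ (+ 2)
  a≈k+2 p = trans (reflexive (≡.cong fromℤ (shift (+ υ p) (+ 𝐪 p)))) (fromℤ-+ (K p) (+ 2))
    where
    shift : ∀ x y → x ℤ.+ + 2 ℤ.* y ≡ x ℤ.- + 2 ℤ.+ + 2 ℤ.* y ℤ.+ + 2
    shift = solve-∀

  Qk≈Qa : Q k ≈ Q a
  Qk≈Qa = begin
    Q k             ≈⟨ Q≈form k ⟩
    k ∙ (L⁺ · k)    ≈⟨ form-translate L⁺
                         -- The kernel of `L⁺` is governed by the transpose of L, hence the appeal
                         -- to symmetry; the left side below uses L itself.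
                         (pseudoInverse-annihilates mp _ λ p → trans
                           (∙-congʳ (λ _ → fromℤ (+ 2)) (laplacian-symmetric adequate p))
                           (laplacian-constant adequate (fromℤ (+ 2)) p))
                         (pseudoInverse-range mp _ (laplacian-constant adequate (fromℤ (+ 2)))) k ⟨
    (λ p → k p + fromℤ (+ 2)) ∙ (L⁺ · λ p → k p + fromℤ (+ 2))
                    ≈⟨ ∙-congʳ _ a≈k+2 ⟨
    a ∙ (L⁺ · λ p → k p + fromℤ (+ 2))
                    ≈⟨ ∙-congˡ a (λ p → ∙-congˡ (L⁺ p) a≈k+2) ⟨
    a ∙ (L⁺ · a)    ≈⟨ Q≈form a ⟨
    Q a             ∎

  2Q : Q k + Q k ≈ fromℤ (+ 2) * Q a
  2Q = begin
    Q k + Q k                 ≈⟨ +-cong Qk≈Qa Qk≈Qa ⟩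
    Q a + Q a                 ≈⟨ +-cong (*-identityˡ (Q a)) (*-identityˡ (Q a)) ⟨
    1# * Q a + 1# * Q a       ≈⟨ distribʳ (Q a) 1# 1# ⟨
    -- `fromℤ (+ 2)` unfolds to `1# + (1# + 0#)`.
    (1# + 1#) * Q a           ≈⟨ *-congʳ (+-congˡ (+-identityʳ 1#)) ⟨
    fromℤ (+ 2) * Q a         ∎

  -- The leading factor is twice deg K because the entries at `p p` and at `q q` each contribute one
  -- deg K.
  2deg : sum k + sum k ≈ fromℤ (+ 2 ℤ.* (+ 2 ℤ.* genus ℤ.- + 2))
  2deg = trans (+-cong deg deg) (sym (fromℤ-double (+ 2 ℤ.* genus ℤ.- + 2)))
    where
    deg : sum k ≈ fromℤ (+ 2 ℤ.* genus ℤ.- + 2)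
    deg = trans (sym (fromℤ-sum K)) (reflexive (≡.cong fromℤ deg-K))

  -- Each diagonal entry is absorbed into `m`, so that its terms become products of a function of
  -- `p` and a function of `q`. In the last term `k q` stands first, so that swapping the indices
  -- gives the summand of `Q k` literally.
  expand : ∀ p q → k p * k q * r p q
           ≈ (m p * k q + k p * m q) - (k p * k q * L⁺ p q + k q * k p * L⁺ q p)
  expand p q = begin
    x * r p q
      ≈⟨ *-congˡ (resistance≈ adequate isR mp p q) ⟩
    x * ((L⁺ p p - L⁺ p q) - (L⁺ q p - L⁺ q q))
      ≈⟨ *-congˡ (+-congˡ (⁻¹-anti-homo‿- (L⁺ q p) (L⁺ q q))) ⟩
    x * ((L⁺ p p - L⁺ p q) + (L⁺ q q - L⁺ q p))
      ≈⟨ *-congˡ (interchange (L⁺ p p) (- L⁺ p q) (L⁺ q q) (- L⁺ q p)) ⟩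
    x * ((L⁺ p p + L⁺ q q) + (- L⁺ p q - L⁺ q p))
      ≈⟨ *-congˡ (+-congˡ (-‿+-comm (L⁺ p q) (L⁺ q p))) ⟩
    x * ((L⁺ p p + L⁺ q q) - (L⁺ p q + L⁺ q p))
      ≈⟨ x[y-z]≈xy-xz x (L⁺ p p + L⁺ q q) (L⁺ p q + L⁺ q p) ⟩
    x * (L⁺ p p + L⁺ q q) - x * (L⁺ p q + L⁺ q p)
      ≈⟨ +-cong (distribˡ x (L⁺ p p) (L⁺ q q)) (-‿cong (distribˡ x (L⁺ p q) (L⁺ q p))) ⟩
    (x * L⁺ p p + x * L⁺ q q) - (x * L⁺ p q + x * L⁺ q p)
      ≈⟨ +-cong
           (+-cong (trans (*-assoc (k p) (k q) (L⁺ p p)) (trans (*-congˡ (*-comm (k q) (L⁺ p p)))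
               (sym (*-assoc (k p) (L⁺ p p) (k q)))))
             (*-assoc (k p) (k q) (L⁺ q q)))
           (-‿cong (+-congˡ (*-congʳ (*-comm (k p) (k q))))) ⟩
    (m p * k q + k p * m q) - (k p * k q * L⁺ p q + k q * k p * L⁺ q p) ∎
    where x = k p * k q
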